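{- Let $\mathbf{C}$ be a small category with countably many arrows, $O$ a set of observations and $T$ an inference system, and suppose that normalizability holds: for every $\Gamma(\mathbf{C})$-algebra $\mathbb{X}$ there is no infinite descending chain of the domination relation $\prec_{T,\mathbb{X}}$. Then the category $\mathbf{Coalg}_{\mathbf{S}_T}$ of $\mathbf{S}_T$-coalgebras (saturated coalgebras) and the category $\mathbf{Coalg}_{\mathbf{N}_T}$ of $\mathbf{N}_T$-coalgebras (normalized coalgebras) are isomorphic.
   Context: Composition is written in diagrammatic order: $f;g$ means first $f$, then $g$. $|\mathbf{C}|$ is the set of objects and $\|\mathbf{C}\|$ the set of arrows of $\mathbf{C}$. Algebras. A $\Gamma(\mathbf{C})$-algebra $\mathbb{X}$ is a family of sets $X=(X_i)_{i\in|\mathbf{C}|}$ with a function $c_{\mathbb{X}}:X_i\to X_j$ for every $c\in\mathbf{C}[i,j]$ such that $(id_i)_{\mathbb{X}}=id_{X_i}$ and $(d;e)_{\mathbb{X}}(x)=e_{\mathbb{X}}(d_{\mathbb{X}}(x))$ (i.e. a functor $\mathbf{C}\to\mathbf{Set}$). Homomorphisms are sorted families of functions commuting with all $c$ (natural transformations); the category is $\mathbf{Alg}_{\Gamma(\mathbf{C})}$. $\int X=\sum_{i}X_i$ is the disjoint union. Sets of transitions. $\mathbf{G}(X)_i$ is the set of (at most) countable subsets of $\sum_{j\in|\mathbf{C}|}\mathbf{C}[i,j]\times O\times\int X$; its elements are sets of transitions $(c,o,q)$. For a homomorphism $h:\mathbb{X}\to\mathbb{Y}$ put $\mathbf{G}(h)(A)=\{(c,o,h(q))\mid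 (c,o,q)\in A\}$. Inference systems. An inference system $T$ is a set of rules $c\xrightarrow[o']{o}d$ with $c\in\mathbf{C}[i,i']$, $d\in\mathbf{C}[j,j']$, $o,o'\in O$ (meaning: if a state of sort $i$ goes with $o$ to a state $q$ of sort $j$, then in context $c$ it goes with $o'$ to $d(q)$). $\Phi(T)$ is the closure of $T$ together with all identity rules $id_i\xrightarrow[o]{o}id_j$ ($i,j\in|\mathbf{C}|$, $o\in O$) under: $c\xrightarrow[o']{o}c'$ and $d\xrightarrow[o'']{o'}d'$ give $c;d\xrightarrow[o'']{o}c';d'$ whenever $c;d$ and $c';d'$ are defined. Derivation. For $d\in\mathbf{C}[i,k]$, a transition $(c_1,o_1,q_1)$ with $c_1$ of source $i$, and a transition $(c_2,o_2,q_2)$ with $c_2$ of source $k$, write $(c_1,o_1,q_1)\vdash^{d}_{T,\mathbb{X}}(c_2,o_2,q_2)$ iff there are $e,e'\in\|\mathbf{C}\|$ with $c_1;e=d;c_2$, $e\xrightarrow[o_2]{o_1}e'\in\Phi(T)$ and $e'_{\mathbb{X}}(q_1)=q_2$. Write $\vdash_{T,\mathbb{X}}$ for $\vdash^{id}_{T,\mathbb{X}}$. Saturated coalgebras. $A\in\mathbf{G}(X)_i$ is saturated if it is closed under $\vdash_{T,\mathbb{X}}$. The endofunctor $\mathbf{S}_T$ of $\mathbf{Alg}_{\Gamma(\mathbf{C})}$ maps $\mathbb{X}$ to the algebra whose carrier of sort $i$ is the set of saturated sets in $\mathbf{G}(X)_i$, with operations $d_{\mathbf{S}_T(\mathbb{X})}(A)=\{t_2\mid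 \exists t_1\in A,\ t_1\vdash^{d}_{T,\mathbb{X}}t_2\}$; on arrows $\mathbf{S}_T(h)(A)=\mathbf{G}(h)(A)$. Normalized coalgebras. $t'\equiv_{T,\mathbb{X}}t$ iff $t'\vdash_{T,\mathbb{X}}t$ and $t\vdash_{T,\mathbb{X}}t'$. $t'$ dominates $t$, written $t'\prec_{T,\mathbb{X}}t$, iff $t'\vdash_{T,\mathbb{X}}t$ and $t\nvdash_{T,\mathbb{X}}t'$. $t\in A$ is redundant in $A$ if some $t'\in A$ has $t'\prec_{T,\mathbb{X}}t$. $A$ is normalized if it contains no redundant transition and is closed under $\equiv_{T,\mathbb{X}}$. $norm_{T,\mathbb{X}}(A)=\{t'\mid \exists t\in A,\ t'\equiv_{T,\mathbb{X}}t,\ t\text{ not redundant in }A\}$. The endofunctor $\mathbf{N}_T$ of $\mathbf{Alg}_{\Gamma(\mathbf{C})}$ maps $\mathbb{X}$ to the algebra whose carrier of sort $i$ is the set of normalized sets in $\mathbf{G}(X)_i$, with operations $d_{\mathbf{N}_T(\mathbb{X})}(A)=norm_{T,\mathbb{X}}(\{t_2\mid \exists t_1\in A,\ t_1\vdash^{d}_{T,\mathbb{X}}t_2\})$; on arrows $h:\mathbb{X}\to\mathbb{Y}$, $\mathbf{N}_T(h)(A)=norm_{T,\mathbb{Y}}(\mathbf{G}(h)(A))$. For an endofunctor $\mathbf{B}$, a $\mathbf{B}$-coalgebra is a pair $\langle\mathbb{X},\alpha:\mathbb{X}\to\mathbf{B}(\mathbb{X})\rangle$; a morphism $\langle\mathbb{X},\alpha\rangle\to\langle\mathbb{Y},\beta\rangle$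 is a homomorphism $f:\mathbb{X}\to\mathbb{Y}$ with $\alpha;\mathbf{B}(f)=f;\beta$.
   Formalization: The formal theorem also assumes that for all arrows c, d and each observation o, only countably many o' have a rule in T from (c, o) to (d, o'); without such a condition the operations of N_T can produce uncountable sets, so N_T need not exist. -}

module Defs where

open import Level using (Level; suc)
open import Axiom.ExcludedMiddle using (ExcludedMiddle)
open import Data.Bool.Base using (Bool; true; false; if_then_else_)
open import Data.Maybe.Base as Maybe using (Maybe; just; nothing)
open import Data.Nat.Base as ℕ using (ℕ; zero)
open import Data.Nat.Properties using (+-suc; +-identityʳ; +-comm)
open import Data.Product using (Σ; Σ-syntax; ∃; ∃-syntax; _×_; _,_; proj₁; proj₂)
open import Function.Bundles using (Func)
open import Relation.Binary using (Rel; Setoid; IsEquivalence)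
open import Relation.Binary.PropositionalEquality
  using (_≡_; refl; sym; trans; cong; subst; module ≡-Reasoning)
open import Relation.Nullary using (¬_; Dec; yes; no; contradiction)
open import Relation.Unary using (Pred; U; _⊆_; _≐_)

------------------------------------------------------------------------
-- Countability

-- An enumeration may skip indices, so its range is an at most countable,
-- possibly empty, set.
Enum : ∀ {a} → Set a → Set a
Enum A = ℕ → Maybe A

infix 4 _∈ᴱ_

_∈ᴱ_ : ∀ {a} {A : Set a} → A → Enum A → Set a
x ∈ᴱ f = ∃[ n ] f n ≡ just x

Countable : ∀ {a p} {A : Set a} → Pred A p → Set _
Countable {A = A} P = Σ[ f ∈ Enum A ] P ≐ (_∈ᴱ f)

private
  next : ℕ × ℕ → ℕ × ℕ
  next (zero    , b) = ℕ.suc b , zero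
  next (ℕ.suc a , b) = a , ℕ.suc b

  unpair : ℕ → ℕ × ℕ
  unpair zero      = zero , zero
  unpair (ℕ.suc n) = next (unpair n)

  Reached : ℕ → ℕ → Set
  Reached a b = ∃[ n ] unpair n ≡ (a , b)

  step : ∀ {p} → (∃[ n ] unpair n ≡ p) → ∃[ n ] unpair n ≡ next p
  step (n , eq) = ℕ.suc n , cong next eq

  walk : ∀ b {a} → Reached (b ℕ.+ a) 0 → Reached a b
  walk zero          r = r
  walk (ℕ.suc b) {a} r = step (walk b (subst (λ s → Reached s 0) (sym (+-suc b a)) r))

  diagonal : ∀ s → Reached s 0
  diagonal zero      = 0 , refl
  diagonal (ℕ.suc s) =
    step (walk s (subst (λ s′ → Reached s′ 0) (sym (+-identityʳ s)) (diagonal s)))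

  unpair-surjective : ∀ a b → Reached a b
  unpair-surjective a b = walk b (diagonal (b ℕ.+ a))

  module _ {a} {A : Set a} where

    single : A → Enum A
    single x _ = just x

    guard : Dec A → Enum A
    guard (yes x) _ = just x
    guard (no _)  _ = nothing

    single-∈ : ∀ x → x ∈ᴱ single x
    single-∈ x = 0 , refl

  bind-at : ∀ {a b} {A : Set a} {B : Set b} → ℕ → (A → Enum B) → Maybe A → Maybe B
  bind-at n k (just x) = k x n
  bind-at n k nothing  = nothing

  infixl 1 _>>=_

  abstract
    _>>=_ : ∀ {a b} {A : Set a} {B : Set b} → Enum A → (A → Enum B) → Enum B
    (f >>= k) n = bind-at (proj₂ (unpair n)) k (f (proj₁ (unpair n)))

    >>=-∈ : ∀ {a b} {A : Set a} {B : Set b} (f : Enum A) (k : A → Enum B) {x y} →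
            x ∈ᴱ f → y ∈ᴱ k x → y ∈ᴱ (f >>= k)
    >>=-∈ f k (m , p) (n , q) with unpair-surjective m n
    ... | r , eq rewrite sym q | sym (cong (bind-at n k) p) =
      r , cong (λ mn → bind-at (proj₂ mn) k (f (proj₁ mn))) eq

    bools : Enum Bool
    bools zero      = just true
    bools (ℕ.suc _) = just false

    union : ∀ {a} {A : Set a} → Enum A → Enum A → Enum A
    union f g = bools >>= λ b → if b then f else g

    union-∈ˡ : ∀ {a} {A : Set a} (f g : Enum A) {x} → x ∈ᴱ f → x ∈ᴱ union f g
    union-∈ˡ f g = >>=-∈ bools (λ b → if b then f else g) {x = true} (0 , refl)

    union-∈ʳ : ∀ {a} {A : Set a} (f g : Enum A) {x} → x ∈ᴱ g → x ∈ᴱ union f g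
    union-∈ʳ f g = >>=-∈ bools (λ b → if b then f else g) {x = false} (1 , refl)

------------------------------------------------------------------------
-- Locally small categories with equality on objects

-- Isomorphism of categories is a strict notion and needs an equality of
-- objects, here an equivalence relation _≈ₒ_.  Accordingly, _≋_ compares
-- arrows whose endpoints are equal only up to _≈ₒ_, and `transport` moves
-- arrows along such equalities.
record Category (ℓ : Level) : Set (suc (suc ℓ)) where
  infix  4 _≈ₒ_ _⇒_ _≋_
  infixr 9 _⨾_
  field
    Obj  : Set (suc ℓ)
    _≈ₒ_ : Rel Obj (suc ℓ)
    _⇒_  : Obj → Obj → Set ℓ
    _≋_  : ∀ {A B A′ B′} → A ⇒ B → A′ ⇒ B′ → Set ℓ
    idA  : ∀ A → A ⇒ A
    _⨾_  : ∀ {A B D} → A ⇒ B → B ⇒ D → A ⇒ D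

    ≈ₒ-isEquivalence : IsEquivalence _≈ₒ_

    ≋-refl  : ∀ {A B} {f : A ⇒ B} → f ≋ f
    ≋-sym   : ∀ {A B A′ B′} {f : A ⇒ B} {g : A′ ⇒ B′} → f ≋ g → g ≋ f
    ≋-trans : ∀ {A B A′ B′ A″ B″} {f : A ⇒ B} {g : A′ ⇒ B′} {h : A″ ⇒ B″} →
              f ≋ g → g ≋ h → f ≋ h

    ≋-source  : ∀ {A B A′ B′} {f : A ⇒ B} {g : A′ ⇒ B′} → f ≋ g → A ≈ₒ A′
    ≋-target  : ∀ {A B A′ B′} {f : A ⇒ B} {g : A′ ⇒ B′} → f ≋ g → B ≈ₒ B′
    transport : ∀ {A B A′ B′} → A ≈ₒ A′ → B ≈ₒ B′ → (f : A ⇒ B) → Σ[ f′ ∈ A′ ⇒ B′ ] f ≋ f′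

    id-cong : ∀ {A A′} → A ≈ₒ A′ → idA A ≋ idA A′
    ⨾-cong  : ∀ {A B D A′ B′ D′} {f : A ⇒ B} {f′ : A′ ⇒ B′} {g : B ⇒ D} {g′ : B′ ⇒ D′} →
              f ≋ f′ → g ≋ g′ → f ⨾ g ≋ f′ ⨾ g′

    identityˡ : ∀ {A B} (f : A ⇒ B) → idA A ⨾ f ≋ f
    identityʳ : ∀ {A B} (f : A ⇒ B) → f ⨾ idA B ≋ f
    assoc     : ∀ {A B D E} (f : A ⇒ B) (g : B ⇒ D) (h : D ⇒ E) →
                (f ⨾ g) ⨾ h ≋ f ⨾ (g ⨾ h)

record Functor {ℓ} (𝒞 𝒟 : Category ℓ) : Set (suc ℓ) where
  private
    module 𝒞 = Category 𝒞
    module 𝒟 = Category 𝒟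
  field
    F₀      : 𝒞.Obj → 𝒟.Obj
    F₁      : ∀ {A B} → A 𝒞.⇒ B → F₀ A 𝒟.⇒ F₀ B
    F₀-cong : ∀ {A B} → A 𝒞.≈ₒ B → F₀ A 𝒟.≈ₒ F₀ B
    F₁-cong : ∀ {A B A′ B′} {f : A 𝒞.⇒ B} {g : A′ 𝒞.⇒ B′} → f 𝒞.≋ g → F₁ f 𝒟.≋ F₁ g
    F-id    : ∀ A → F₁ (𝒞.idA A) 𝒟.≋ 𝒟.idA (F₀ A)
    F-⨾     : ∀ {A B D} (f : A 𝒞.⇒ B) (g : B 𝒞.⇒ D) → F₁ (f 𝒞.⨾ g) 𝒟.≋ F₁ f 𝒟.⨾ F₁ g

infix 4 _≅_

record _≅_ {ℓ} (𝒞 𝒟 : Category ℓ) : Set (suc ℓ) where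
  private
    module 𝒞 = Category 𝒞
    module 𝒟 = Category 𝒟
  field
    to   : Functor 𝒞 𝒟
    from : Functor 𝒟 𝒞
  open Functor
  field
    from∘to₀ : ∀ A → F₀ from (F₀ to A) 𝒞.≈ₒ A
    from∘to₁ : ∀ {A B} (f : A 𝒞.⇒ B) → F₁ from (F₁ to f) 𝒞.≋ f
    to∘from₀ : ∀ A → F₀ to (F₀ from A) 𝒟.≈ₒ A
    to∘from₁ : ∀ {A B} (f : A 𝒟.⇒ B) → F₁ to (F₁ from f) 𝒟.≋ f

module _ {ℓ} {𝒞 : Category ℓ} (𝐁 : Functor 𝒞 𝒞) where
  open Category 𝒞
  open Functor 𝐁

  record Coalgebra : Set (suc ℓ) where
    field
      carrier   : Obj
      structure : carrier ⇒ F₀ carrier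

  open Coalgebra

  record CoalgebraMorphism (P Q : Coalgebra) : Set ℓ where
    field
      hom      : carrier P ⇒ carrier Q
      commutes : structure P ⨾ F₁ hom ≋ hom ⨾ structure Q

  open CoalgebraMorphism

  -- The carriers are then equal too, by ≋-source.
  record _≈ᶜ_ (P Q : Coalgebra) : Set (suc ℓ) where
    constructor [_]
    field
      structure-≋ : structure P ≋ structure Q

  record _≋ᶜ_ {P Q P′ Q′} (f : CoalgebraMorphism P Q) (g : CoalgebraMorphism P′ Q′) : Set ℓ where
    constructor mk≋
    field
      source-≋ : structure P ≋ structure P′
      target-≋ : structure Q ≋ structure Q′
      hom-≋    : hom f ≋ hom g

  private
    idᶜ : ∀ P → CoalgebraMorphism P P
    idᶜ P = record
      { hom      = idA (carrier P)
      ; commutes = ≋-trans (⨾-cong ≋-refl (F-id _))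
                     (≋-trans (identityʳ _) (≋-sym (identityˡ _)))
      }

    _⨾ᶜ_ : ∀ {P Q R} → CoalgebraMorphism P Q → CoalgebraMorphism Q R → CoalgebraMorphism P R
    f ⨾ᶜ g = record
      { hom      = hom f ⨾ hom g
      ; commutes = ≋-trans (⨾-cong ≋-refl (F-⨾ _ _))
                     (≋-trans (≋-sym (assoc _ _ _))
                     (≋-trans (⨾-cong (commutes f) ≋-refl)
                     (≋-trans (assoc _ _ _)
                     (≋-trans (⨾-cong ≋-refl (commutes g))
                     (≋-sym (assoc _ _ _))))))
      }

    transportᶜ : ∀ {P Q P′ Q′} → P ≈ᶜ P′ → Q ≈ᶜ Q′ → (f : CoalgebraMorphism P Q) →
                 Σ[ f′ ∈ CoalgebraMorphism P′ Q′ ] f ≋ᶜ f′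
    transportᶜ [ p ] [ q ] f with transport (≋-source p) (≋-source q) (hom f)
    ... | f′ , r = record
      { hom      = f′
      ; commutes = ≋-trans (⨾-cong (≋-sym p) (F₁-cong (≋-sym r)))
                     (≋-trans (commutes f) (⨾-cong r q))
      } , mk≋ p q r

  Coalg : Category ℓ
  Coalg = record
    { Obj  = Coalgebra
    ; _≈ₒ_ = _≈ᶜ_
    ; _⇒_  = CoalgebraMorphism
    ; _≋_  = _≋ᶜ_
    ; idA  = idᶜ
    ; _⨾_  = _⨾ᶜ_
    ; ≈ₒ-isEquivalence = record
      { refl  = [ ≋-refl ]
      ; sym   = λ { [ p ] → [ ≋-sym p ] }
      ; trans = λ { [ p ] [ q ] → [ ≋-trans p q ] }
      }
    ; ≋-refl    = mk≋ ≋-refl ≋-refl ≋-refl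
    ; ≋-sym     = λ { (mk≋ p q r) → mk≋ (≋-sym p) (≋-sym q) (≋-sym r) }
    ; ≋-trans   = λ { (mk≋ p q r) (mk≋ p′ q′ r′) →
                    mk≋ (≋-trans p p′) (≋-trans q q′) (≋-trans r r′) }
    ; ≋-source  = λ { (mk≋ p _ _) → [ p ] }
    ; ≋-target  = λ { (mk≋ _ q _) → [ q ] }
    ; transport = transportᶜ
    ; id-cong   = λ { [ p ] → mk≋ p p (id-cong (≋-source p)) }
    ; ⨾-cong    = λ { (mk≋ p _ r) (mk≋ _ q s) → mk≋ p q (⨾-cong r s) }
    ; identityˡ = λ f → mk≋ ≋-refl ≋-refl (identityˡ (hom f))
    ; identityʳ = λ f → mk≋ ≋-refl ≋-refl (identityʳ (hom f))
    ; assoc     = λ f g h → mk≋ ≋-refl ≋-refl (assoc (hom f) (hom g) (hom h))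
    }

------------------------------------------------------------------------
-- Algebras

record SmallCategory (ℓ : Level) : Set (suc ℓ) where
  infixr 9 _⨾_
  field
    Obj       : Set ℓ
    Hom       : Obj → Obj → Set ℓ
    id        : ∀ i → Hom i i
    _⨾_       : ∀ {i j k} → Hom i j → Hom j k → Hom i k
    identityˡ : ∀ {i j} (c : Hom i j) → id i ⨾ c ≡ c
    identityʳ : ∀ {i j} (c : Hom i j) → c ⨾ id j ≡ c
    assoc     : ∀ {i j k l} (c : Hom i j) (d : Hom j k) (e : Hom k l) →
                (c ⨾ d) ⨾ e ≡ c ⨾ (d ⨾ e)

  Arrow : Set ℓ
  Arrow = Σ[ i ∈ Obj ] Σ[ j ∈ Obj ] Hom i j

CountablyManyArrows : ∀ {ℓ} → SmallCategory ℓ → Set ℓ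
CountablyManyArrows C = Countable {A = SmallCategory.Arrow C} U

-- Carriers are setoids because the carriers of the algebras 𝐒(X) and 𝐍(X)
-- below consist of sets, which are compared extensionally.
record Algebra {ℓ} (C : SmallCategory ℓ) : Set (suc ℓ) where
  no-eta-equality
  open SmallCategory C
  field
    Carrier : Obj → Setoid ℓ ℓ
    op      : ∀ {i j} → Hom i j → Func (Carrier i) (Carrier j)

  ∣_∣ : Obj → Set ℓ
  ∣ i ∣ = Setoid.Carrier (Carrier i)

  infix 4 _≈_

  _≈_ : ∀ {i} → Rel ∣ i ∣ ℓ
  _≈_ {i} = Setoid._≈_ (Carrier i)

  infixr 8 _·_

  _·_ : ∀ {i j} → Hom i j → ∣ i ∣ → ∣ j ∣
  c · x = Func.to (op c) x

  field
    op-id : ∀ {i} (x : ∣ i ∣) → id i · x ≈ x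
    op-⨾  : ∀ {i j k} (d : Hom i j) (e : Hom j k) (x : ∣ i ∣) → (d ⨾ e) · x ≈ e · d · x

  ·-cong : ∀ {i j} (c : Hom i j) {x y} → x ≈ y → c · x ≈ c · y
  ·-cong c = Func.cong (op c)

  ≈-refl : ∀ {i} {x : ∣ i ∣} → x ≈ x
  ≈-refl {i} = Setoid.refl (Carrier i)

  ≈-sym : ∀ {i} {x y : ∣ i ∣} → x ≈ y → y ≈ x
  ≈-sym {i} = Setoid.sym (Carrier i)

  ≈-trans : ∀ {i} {x y z : ∣ i ∣} → x ≈ y → y ≈ z → x ≈ z
  ≈-trans {i} = Setoid.trans (Carrier i)

record Homomorphism {ℓ} {C : SmallCategory ℓ} (X Y : Algebra C) : Set ℓ where
  no-eta-equality
  open SmallCategory C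
  private
    module X = Algebra X
    module Y = Algebra Y
  field
    fun : ∀ i → Func (X.Carrier i) (Y.Carrier i)

  app : ∀ {i} → X.∣ i ∣ → Y.∣ i ∣
  app {i} = Func.to (fun i)

  field
    natural : ∀ {i j} (c : Hom i j) (x : X.∣ i ∣) → app (c X.· x) Y.≈ c Y.· app x

  app-cong : ∀ {i} {x y : X.∣ i ∣} → x X.≈ y → app x Y.≈ app y
  app-cong {i} = Func.cong (fun i)

module _ {ℓ} (C : SmallCategory ℓ) where
  open Homomorphism
  open Algebra using (≈-refl; ≈-sym; ≈-trans)

  data _≋ʰ_ {X Y : Algebra C} (f : Homomorphism X Y) :
            ∀ {X′ Y′ : Algebra C} → Homomorphism X′ Y′ → Set ℓ where
    pointwise : {g : Homomorphism X Y} →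
                (∀ {i} (x : Algebra.∣_∣ X i) → Algebra._≈_ Y (app f x) (app g x)) → f ≋ʰ g

  private
    idʰ : (X : Algebra C) → Homomorphism X X
    idʰ X .fun i       = record { to = λ x → x ; cong = λ p → p }
    idʰ X .natural c x = ≈-refl X

    _⨾ʰ_ : {X Y Z : Algebra C} → Homomorphism X Y → Homomorphism Y Z → Homomorphism X Z
    (f ⨾ʰ g) .fun i = record
      { to   = λ x → app g (app f x)
      ; cong = λ p → app-cong g (app-cong f p)
      }
    _⨾ʰ_ {Z = Z} f g .natural c x =
      ≈-trans Z (app-cong g (natural f c x)) (natural g c (app f x))

    ≋ʰ-sym : {X Y X′ Y′ : Algebra C} {f : Homomorphism X Y} {g : Homomorphism X′ Y′} →
             f ≋ʰ g → g ≋ʰ f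
    ≋ʰ-sym {Y = Y} (pointwise p) = pointwise (λ x → ≈-sym Y (p x))

    ≋ʰ-trans : {X Y X′ Y′ X″ Y″ : Algebra C} {f : Homomorphism X Y} {g : Homomorphism X′ Y′}
               {h : Homomorphism X″ Y″} → f ≋ʰ g → g ≋ʰ h → f ≋ʰ h
    ≋ʰ-trans {Y = Y} (pointwise p) (pointwise q) = pointwise (λ x → ≈-trans Y (p x) (q x))

    ⨾ʰ-cong : {X Y Z X′ Y′ Z′ : Algebra C} {f : Homomorphism X Y} {f′ : Homomorphism X′ Y′}
              {g : Homomorphism Y Z} {g′ : Homomorphism Y′ Z′} →
              f ≋ʰ f′ → g ≋ʰ g′ → (f ⨾ʰ g) ≋ʰ (f′ ⨾ʰ g′)
    ⨾ʰ-cong {Z = Z} {g = g} (pointwise p) (pointwise q) =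
      pointwise (λ x → ≈-trans Z (app-cong g (p x)) (q _))

    ≋ʰ-source : {X Y X′ Y′ : Algebra C} {f : Homomorphism X Y} {g : Homomorphism X′ Y′} →
                f ≋ʰ g → X ≡ X′
    ≋ʰ-source (pointwise _) = refl

    ≋ʰ-target : {X Y X′ Y′ : Algebra C} {f : Homomorphism X Y} {g : Homomorphism X′ Y′} →
                f ≋ʰ g → Y ≡ Y′
    ≋ʰ-target (pointwise _) = refl

    transportʰ : {X Y X′ Y′ : Algebra C} → X ≡ X′ → Y ≡ Y′ → (f : Homomorphism X Y) →
                 Σ[ f′ ∈ Homomorphism X′ Y′ ] f ≋ʰ f′
    transportʰ {Y = Y} refl refl f = f , pointwise (λ _ → ≈-refl Y)

    idʰ-cong : {X Y : Algebra C} → X ≡ Y → idʰ X ≋ʰ idʰ Y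
    idʰ-cong {X} refl = pointwise (λ _ → ≈-refl X)

  Alg : Category ℓ
  Alg = record
    { Obj  = Algebra C
    ; _≈ₒ_ = _≡_
    ; _⇒_  = Homomorphism
    ; _≋_  = λ f g → f ≋ʰ g
    ; idA  = idʰ
    ; _⨾_  = _⨾ʰ_
    ; ≈ₒ-isEquivalence = record { refl = refl ; sym = sym ; trans = trans }
    ; ≋-refl    = λ {_} {Y} → pointwise (λ _ → ≈-refl Y)
    ; ≋-sym     = ≋ʰ-sym
    ; ≋-trans   = ≋ʰ-trans
    ; ≋-source  = ≋ʰ-source
    ; ≋-target  = ≋ʰ-target
    ; transport = transportʰ
    ; id-cong   = idʰ-cong
    ; ⨾-cong    = ⨾ʰ-cong
    ; identityˡ = λ {_} {Y} f → pointwise (λ _ → ≈-refl Y)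
    ; identityʳ = λ {_} {Y} f → pointwise (λ _ → ≈-refl Y)
    ; assoc     = λ {_} {_} {_} {Y} f g h → pointwise (λ _ → ≈-refl Y)
    }

------------------------------------------------------------------------
-- Sets of transitions

-- An element (ctx , obs , state) of Σⱼ C[i,j] × O × ∫X.
record Transition {ℓ} {C : SmallCategory ℓ} (O : Set ℓ) (X : Algebra C)
                  (i : SmallCategory.Obj C) : Set ℓ where
  constructor ⟨_,_,_⟩
  open SmallCategory C
  field
    {tgt}  : Obj
    ctx    : Hom i tgt
    obs    : O
    {sort} : Obj
    state  : Algebra.∣_∣ X sort

module Sets {ℓ} {C : SmallCategory ℓ} (O : Set ℓ) (X : Algebra C) where
  open SmallCategory C
  open Algebra X

  infix 4 _≈ᵗ_ _∈_ _≈ˢ_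

  data _≈ᵗ_ {i} : Rel (Transition O X i) ℓ where
    state-≈ : ∀ {j k} {c : Hom i j} {o} {p q : ∣ k ∣} → p ≈ q → ⟨ c , o , p ⟩ ≈ᵗ ⟨ c , o , q ⟩

  -- A countable set of transitions is given by an enumeration, two
  -- enumerations being equal when they have the same elements.  Unlike sets
  -- given by predicates, these do not raise the universe level, as required
  -- for 𝐒 and 𝐍 to be endofunctors.
  𝐆 : Obj → Set ℓ
  𝐆 i = Enum (Transition O X i)

  _∈_ : ∀ {i} → Transition O X i → 𝐆 i → Set ℓ
  t ∈ A = ∃[ s ] s ∈ᴱ A × s ≈ᵗ t

  _≈ˢ_ : ∀ {i} → Rel (𝐆 i) ℓ
  A ≈ˢ B = (_∈ A) ≐ (_∈ B)

  ≈ᵗ-refl : ∀ {i} {t : Transition O X i} → t ≈ᵗ t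
  ≈ᵗ-refl = state-≈ ≈-refl

  ≈ᵗ-sym : ∀ {i} {s t : Transition O X i} → s ≈ᵗ t → t ≈ᵗ s
  ≈ᵗ-sym (state-≈ p) = state-≈ (≈-sym p)

  ≈ᵗ-trans : ∀ {i} {r s t : Transition O X i} → r ≈ᵗ s → s ≈ᵗ t → r ≈ᵗ t
  ≈ᵗ-trans (state-≈ p) (state-≈ q) = state-≈ (≈-trans p q)

  ∈-resp-≈ᵗ : ∀ {i} {A : 𝐆 i} {s t} → s ≈ᵗ t → s ∈ A → t ∈ A
  ∈-resp-≈ᵗ p (r , r∈A , q) = r , r∈A , ≈ᵗ-trans q p

  ≈ˢ-refl : ∀ {i} {A : 𝐆 i} → A ≈ˢ A
  ≈ˢ-refl = (λ m → m) , (λ m → m)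

  ≈ˢ-sym : ∀ {i} {A B : 𝐆 i} → A ≈ˢ B → B ≈ˢ A
  ≈ˢ-sym (p , q) = q , p

  ≈ˢ-trans : ∀ {i} {A B D : 𝐆 i} → A ≈ˢ B → B ≈ˢ D → A ≈ˢ D
  ≈ˢ-trans (p , q) (p′ , q′) = (λ m → p′ (p m)) , (λ m → q (q′ m))

module _ {ℓ} {C : SmallCategory ℓ} {O : Set ℓ} {X Y : Algebra C} (h : Homomorphism X Y) where
  open Homomorphism h
  private
    module X = Sets O X
    module Y = Sets O Y

  mapᵗ : ∀ {i} → Transition O X i → Transition O Y i
  mapᵗ ⟨ c , o , q ⟩ = ⟨ c , o , app q ⟩

  -- 𝐆(h)
  𝐆₁ : ∀ {i} → X.𝐆 i → Y.𝐆 i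
  𝐆₁ A n = Maybe.map mapᵗ (A n)

  mapᵗ-cong : ∀ {i} {s t : Transition O X i} → s X.≈ᵗ t → mapᵗ s Y.≈ᵗ mapᵗ t
  mapᵗ-cong (X.state-≈ p) = Y.state-≈ (app-cong p)

  ∈-𝐆₁ : ∀ {i} (A : X.𝐆 i) → (Y._∈ 𝐆₁ A) ≐ (λ t → ∃[ s ] s X.∈ A × mapᵗ s Y.≈ᵗ t)
  ∈-𝐆₁ A = to , from
    where
    unmap : ∀ (m : Maybe (Transition O X _)) {t} → Maybe.map mapᵗ m ≡ just t →
            ∃[ s ] m ≡ just s × mapᵗ s ≡ t
    unmap (just s) refl = s , refl , refl

    to : (Y._∈ 𝐆₁ A) ⊆ (λ t → ∃[ s ] s X.∈ A × mapᵗ s Y.≈ᵗ t)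
    to (r , (n , eq) , p) with unmap (A n) eq
    ... | s , eq′ , refl = s , (s , (n , eq′) , X.≈ᵗ-refl) , p

    from : (λ t → ∃[ s ] s X.∈ A × mapᵗ s Y.≈ᵗ t) ⊆ (Y._∈ 𝐆₁ A)
    from (s , (r , (n , eq) , p) , q) =
      mapᵗ r , (n , cong (Maybe.map mapᵗ) eq) , Y.≈ᵗ-trans (mapᵗ-cong p) q

------------------------------------------------------------------------
-- Inference systems

record InferenceSystem {ℓ} (C : SmallCategory ℓ) (O : Set ℓ) : Set (suc ℓ) where
  open SmallCategory C
  field
    -- Rule c o o′ d stands for the rule from (c , o) to (d , o′), with o
    -- written above and o′ below the arrow.
    Rule : ∀ {i i′ j j′} → Hom i i′ → O → O → Hom j j′ → Set ℓ

module _ {ℓ} {C : SmallCategory ℓ} {O : Set ℓ} (T : InferenceSystem C O) where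
  open SmallCategory C
  open InferenceSystem T
  open Transition

  data Φ : ∀ {i i′ j j′} → Hom i i′ → O → O → Hom j j′ → Set ℓ where
    rule     : ∀ {i i′ j j′} {c : Hom i i′} {d : Hom j j′} {o o′} → Rule c o o′ d → Φ c o o′ d
    identity : ∀ i j o → Φ (id i) o o (id j)
    compose  : ∀ {i j k i′ j′ k′} {c : Hom i j} {d : Hom j k} {c′ : Hom i′ j′} {d′ : Hom j′ k′}
               {o o′ o″} → Φ c o o′ c′ → Φ d o′ o″ d′ → Φ (c ⨾ d) o o″ (c′ ⨾ d′)

  -- If C has countably many arrows, this is necessary and sufficient for the
  -- sets of derivable transitions that define the operations of 𝐒(X) to be
  -- countable for all X.  It holds if O is countable, or if T is.
  CountablyBranching : Set ℓ
  CountablyBranching = ∀ {i i′ j j′} (c : Hom i i′) (d : Hom j j′) o → Countable (λ o′ → Rule c o o′ d)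

  module Derivation (X : Algebra C) where
    open Algebra X
    open Sets O X

    infix 4 _⊢[_]_ _⊢_ _≡ᵗ_ _≺_

    record _⊢[_]_ {i k} (t₁ : Transition O X i) (d : Hom i k) (t₂ : Transition O X k) : Set ℓ where
      field
        e         : Hom (tgt t₁) (tgt t₂)
        e′        : Hom (sort t₁) (sort t₂)
        square    : ctx t₁ ⨾ e ≡ d ⨾ ctx t₂
        derivable : Φ e (obs t₁) (obs t₂) e′
        result    : e′ · state t₁ ≈ state t₂

    _⊢_ : ∀ {i} → Rel (Transition O X i) ℓ
    _⊢_ {i} t₁ t₂ = t₁ ⊢[ id i ] t₂

    _≡ᵗ_ : ∀ {i} → Rel (Transition O X i) ℓ
    t′ ≡ᵗ t = t′ ⊢ t × t ⊢ t′

    _≺_ : ∀ {i} → Rel (Transition O X i) ℓ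
    t′ ≺ t = t′ ⊢ t × ¬ (t ⊢ t′)

    Saturated : ∀ {i} → 𝐆 i → Set ℓ
    Saturated A = ∀ {t₁ t₂} → t₁ ∈ A → t₁ ⊢ t₂ → t₂ ∈ A

    Redundant : ∀ {i} → 𝐆 i → Pred (Transition O X i) ℓ
    Redundant A t = ∃[ t′ ] t′ ∈ A × t′ ≺ t

    Normalized : ∀ {i} → 𝐆 i → Set ℓ
    Normalized A = (∀ {t} → t ∈ A → ¬ Redundant A t) ×
                   (∀ {t′ t} → t ∈ A → t′ ≡ᵗ t → t′ ∈ A)

    -- The transitions derivable from A in context d.
    Derivable : ∀ {i k} → Hom i k → 𝐆 i → Pred (Transition O X k) ℓ
    Derivable d A t₂ = ∃[ t₁ ] t₁ ∈ A × t₁ ⊢[ d ] t₂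

    -- The elements of norm(A).
    Norm : ∀ {i} → 𝐆 i → Pred (Transition O X i) ℓ
    Norm A t′ = ∃[ t ] t ∈ A × t′ ≡ᵗ t × ¬ Redundant A t

    InfiniteDescendingChain : Set ℓ
    InfiniteDescendingChain =
      ∃[ i ] Σ[ t ∈ (ℕ → Transition O X i) ] (∀ n → t (ℕ.suc n) ≺ t n)

    ⊢-resp-≈ᵗ : ∀ {i k} {d : Hom i k} {t₁ s₁ t₂ s₂} →
                t₁ ≈ᵗ s₁ → t₂ ≈ᵗ s₂ → t₁ ⊢[ d ] t₂ → s₁ ⊢[ d ] s₂
    ⊢-resp-≈ᵗ (state-≈ p) (state-≈ q) D = record
      { e = e ; e′ = e′ ; square = square ; derivable = derivable
      ; result = ≈-trans (·-cong e′ (≈-sym p)) (≈-trans result q)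
      }
      where open _⊢[_]_ D

    ≈ᵗ⇒⊢ : ∀ {i} {s t : Transition O X i} → s ≈ᵗ t → s ⊢ t
    ≈ᵗ⇒⊢ (state-≈ {c = c} {o} p) = record
      { e = id _ ; e′ = id _
      ; square = trans (identityʳ c) (sym (identityˡ c))
      ; derivable = identity _ _ o
      ; result = ≈-trans (op-id _) p
      }

    ⊢-refl : ∀ {i} {t : Transition O X i} → t ⊢ t
    ⊢-refl = ≈ᵗ⇒⊢ ≈ᵗ-refl

    ⊢-⨾ : ∀ {i j k} {d : Hom i j} {f : Hom j k} {t₁ t₂ t₃} →
          t₁ ⊢[ d ] t₂ → t₂ ⊢[ f ] t₃ → t₁ ⊢[ d ⨾ f ] t₃
    ⊢-⨾ {d = d} {f} {t₁} {t₂} {t₃} D E = record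
      { e = D.e ⨾ E.e
      ; e′ = D.e′ ⨾ E.e′
      ; square = begin
          ctx t₁ ⨾ D.e ⨾ E.e     ≡⟨ assoc _ _ _ ⟨
          (ctx t₁ ⨾ D.e) ⨾ E.e   ≡⟨ cong (_⨾ E.e) D.square ⟩
          (d ⨾ ctx t₂) ⨾ E.e     ≡⟨ assoc _ _ _ ⟩
          d ⨾ (ctx t₂ ⨾ E.e)     ≡⟨ cong (d ⨾_) E.square ⟩
          d ⨾ (f ⨾ ctx t₃)       ≡⟨ assoc _ _ _ ⟨
          (d ⨾ f) ⨾ ctx t₃       ∎
      ; derivable = compose D.derivable E.derivable
      ; result = ≈-trans (op-⨾ _ _ _) (≈-trans (·-cong E.e′ D.result) E.result)
      }
      where
      module D = _⊢[_]_ D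
      module E = _⊢[_]_ E
      open ≡-Reasoning

    ⊢-split : ∀ {i j k} {d : Hom i j} {f : Hom j k} {t₁ t₃} →
              t₁ ⊢[ d ⨾ f ] t₃ → ∃[ t₂ ] t₁ ⊢[ d ] t₂ × t₂ ⊢[ f ] t₃
    ⊢-split {d = d} {f} {t₁} {t₃} D = ⟨ f ⨾ ctx t₃ , obs t₃ , state t₃ ⟩ , left , right
      where
      open _⊢[_]_ D
      left = record
        { e = e ; e′ = e′
        ; square = trans square (assoc _ _ _)
        ; derivable = derivable ; result = result
        }
      right = record
        { e = id _ ; e′ = id _
        ; square = identityʳ _
        ; derivable = identity _ _ _ ; result = op-id _
        }

    ⊢-idˡ : ∀ {i k} {d : Hom i k} {t₁ t₂ t₃} → t₁ ⊢ t₂ → t₂ ⊢[ d ] t₃ → t₁ ⊢[ d ] t₃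
    ⊢-idˡ {d = d} {t₁} {t₃ = t₃} D E = subst (λ f → t₁ ⊢[ f ] t₃) (identityˡ d) (⊢-⨾ D E)

    ⊢-idʳ : ∀ {i k} {d : Hom i k} {t₁ t₂ t₃} → t₁ ⊢[ d ] t₂ → t₂ ⊢ t₃ → t₁ ⊢[ d ] t₃
    ⊢-idʳ {d = d} {t₁} {t₃ = t₃} D E = subst (λ f → t₁ ⊢[ f ] t₃) (identityʳ d) (⊢-⨾ D E)

    ⊢-trans : ∀ {i} {r s t : Transition O X i} → r ⊢ s → s ⊢ t → r ⊢ t
    ⊢-trans = ⊢-idˡ

    ≡ᵗ-trans : ∀ {i} {r s t : Transition O X i} → r ≡ᵗ s → s ≡ᵗ t → r ≡ᵗ t
    ≡ᵗ-trans (p , q) (p′ , q′) = ⊢-trans p p′ , ⊢-trans q′ q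

    Redundant-mono : ∀ {i} {A B : 𝐆 i} {t} → (_∈ A) ⊆ (_∈ B) → Redundant A t → Redundant B t
    Redundant-mono A⊆B (t′ , t′∈A , d) = t′ , A⊆B t′∈A , d

  -- Normalizability: no infinite chain … ≺ t₂ ≺ t₁ ≺ t₀ in any algebra.
  Normalizable : Set (suc ℓ)
  Normalizable = ∀ X → ¬ Derivation.InfiniteDescendingChain X

  module _ {X Y : Algebra C} (h : Homomorphism X Y) where
    open Homomorphism h
    private
      module X = Derivation X
      module Y = Derivation Y
      module AX = Algebra X
      module AY = Algebra Y
      module SX = Sets O X
      module SY = Sets O Y

    mapᵗ-⊢ : ∀ {i k} {d : Hom i k} {t₁ t₂} → t₁ X.⊢[ d ] t₂ → mapᵗ h t₁ Y.⊢[ d ] mapᵗ h t₂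
    mapᵗ-⊢ D = record
      { e = e ; e′ = e′ ; square = square ; derivable = derivable
      ; result = AY.≈-trans (AY.≈-sym (natural e′ _)) (app-cong result)
      }
      where open X._⊢[_]_ D

    mapᵗ-⊢⁻¹ : ∀ {i k} {d : Hom i k} {t₁ t₂} → mapᵗ h t₁ Y.⊢[ d ] t₂ →
               ∃[ s ] t₁ X.⊢[ d ] s × mapᵗ h s SY.≈ᵗ t₂
    mapᵗ-⊢⁻¹ {t₁ = t₁} {t₂} D = ⟨ ctx t₂ , obs t₂ , e′ AX.· state t₁ ⟩ , record
      { e = e ; e′ = e′ ; square = square ; derivable = derivable ; result = AX.≈-refl }
      , SY.state-≈ (AY.≈-trans (natural e′ _) result)
      where open Y._⊢[_]_ D

------------------------------------------------------------------------
-- Countability of the sets of derivable transitions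

-- Excluded middle is used to separate norm(A), whose definition negates
-- redundancy, from an enumeration, and to find irredundant transitions.
module Endofunctors {ℓ} (em : ExcludedMiddle ℓ) {C : SmallCategory ℓ} (arr : CountablyManyArrows C)
                    {O : Set ℓ} (T : InferenceSystem C O) (br : CountablyBranching T) where
  open SmallCategory C
  open Transition

  private
    arrows : Enum Arrow
    arrows = proj₁ arr

    ∈-arrows : ∀ a → a ∈ᴱ arrows
    ∈-arrows a = proj₁ (proj₂ arr) {a} _

    naturals : Enum ℕ
    naturals n = just n

    refl-∈ : ∀ {i : Obj} (d : Dec (i ≡ i)) → refl ∈ᴱ guard d
    refl-∈ (yes refl) = 0 , refl
    refl-∈ (no i≢i)   = contradiction refl i≢i

    source target : Arrow → Obj
    source (i , _ , _) = i
    target (_ , j , _) = j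

    comp : (c d : Arrow) → target c ≡ source d → Arrow
    comp (i , _ , c) (_ , k , d) refl = i , k , c ⨾ d

    idArrow : Arrow → Arrow
    idArrow (i , _ , _) = i , i , id i

    -- (c , d , o′) stands for Φ c o o′ d, where o is fixed.
    Successor : Set ℓ
    Successor = Arrow × Arrow × O

    basic₂ : O → Arrow → Arrow → Enum Successor
    basic₂ o a@(_ , _ , c) b@(_ , _ , d) =
      union (single (idArrow a , idArrow b , o))
            (proj₁ (br c d o) >>= λ o′ → single (a , b , o′))

    basic₁ : O → Arrow → Enum Successor
    basic₁ o a = arrows >>= basic₂ o a

    basic : O → Enum Successor
    basic o = arrows >>= basic₁ o

    Fits Fits′ : Successor → Successor → Set ℓ
    Fits  (c , _)      (d , _)      = target c ≡ source d
    Fits′ (_ , c′ , _) (_ , d′ , _) = target c′ ≡ source d′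

    combine₄ : ∀ s s′ → Fits s s′ → Fits′ s s′ → Enum Successor
    combine₄ (c , c′ , _) (d , d′ , o″) p q = single (comp c d p , comp c′ d′ q , o″)

    combine₃ : ∀ s s′ → Fits s s′ → Enum Successor
    combine₃ s s′ p = guard (em {Fits′ s s′}) >>= combine₄ s s′ p

    combine₂ : Successor → Successor → Enum Successor
    combine₂ s s′ = guard (em {Fits s s′}) >>= combine₃ s s′

    combine₁ : (O → Enum Successor) → Successor → Enum Successor
    combine₁ f s@(_ , _ , o′) = f o′ >>= combine₂ s

    -- Derivations of height at most n.
    upTo : ℕ → O → Enum Successor
    upTo zero      o = basic o
    upTo (ℕ.suc n) o = union (upTo n o) (upTo n o >>= combine₁ (upTo n))

    upTo-mono : ∀ k {n o s} → s ∈ᴱ upTo n o → s ∈ᴱ upTo (k ℕ.+ n) o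
    upTo-mono zero          s∈ = s∈
    upTo-mono (ℕ.suc k) {n} s∈ =
      union-∈ˡ (upTo (k ℕ.+ n) _) (upTo (k ℕ.+ n) _ >>= combine₁ (upTo (k ℕ.+ n))) (upTo-mono k s∈)

    ∈-basic₁ : ∀ {o a b s} → s ∈ᴱ basic₂ o a b → s ∈ᴱ basic o
    ∈-basic₁ {o} {a} {b} s∈ =
      >>=-∈ arrows (basic₁ o) (∈-arrows a) (>>=-∈ arrows (basic₂ o a) (∈-arrows b) s∈)

    Φ⇒upTo : ∀ {i i′ j j′} {c : Hom i i′} {d : Hom j j′} {o o′} → Φ T c o o′ d →
             ∃[ n ] ((i , i′ , c) , (j , j′ , d) , o′) ∈ᴱ upTo n o
    Φ⇒upTo (rule {c = c} {d} {o} {o′} r) =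
      0 , ∈-basic₁ {a = a} {b} (union-∈ʳ (single _) (rules >>= λ o″ → single (a , b , o″))
            (>>=-∈ rules (λ o″ → single (a , b , o″)) (proj₁ (proj₂ (br c d o)) r) (single-∈ _)))
      where
      a = _ , _ , c
      b = _ , _ , d
      rules = proj₁ (br c d o)
    Φ⇒upTo (identity i j o) =
      0 , ∈-basic₁ {a = i , i , id i} {j , j , id j} (union-∈ˡ (single _) _ (single-∈ _))
    Φ⇒upTo (compose {c = c} {d} {c′} {d′} {o} {o′} {o″} p q) with Φ⇒upTo p | Φ⇒upTo q
    ... | m , p∈ | n , q∈ = ℕ.suc h ,
      union-∈ʳ (upTo h o) (upTo h o >>= combine₁ (upTo h))
        (>>=-∈ (upTo h o) (combine₁ (upTo h)) (subst (λ k → s ∈ᴱ upTo k o) (+-comm n m) (upTo-mono n p∈))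
          (>>=-∈ (upTo h o′) (combine₂ s) (upTo-mono m q∈)
            (>>=-∈ _ (combine₃ s s′) (refl-∈ em)
              (>>=-∈ _ (combine₄ s s′ refl) (refl-∈ em) (single-∈ _)))))
      where
      h  = m ℕ.+ n
      s  = (_ , _ , c) , (_ , _ , c′) , o′
      s′ = (_ , _ , d) , (_ , _ , d′) , o″

    successors : O → Enum Successor
    successors o = naturals >>= λ n → upTo n o

    ∈-successors : ∀ {i i′ j j′} {c : Hom i i′} {d : Hom j j′} {o o′} → Φ T c o o′ d →
                   ((i , i′ , c) , (j , j′ , d) , o′) ∈ᴱ successors o
    ∈-successors {o = o} r with Φ⇒upTo r
    ... | n , s∈ = >>=-∈ naturals (λ n → upTo n o) (n , refl) s∈

  module _ (X : Algebra C) where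
    open Algebra X
    open Sets O X
    open Derivation T X

    private
      target-state : ∀ {k} (t₁ : Transition O X k) (b : Arrow) → sort t₁ ≡ source b → ∣ target b ∣
      target-state t₁ (_ , _ , e′) refl = e′ · state t₁

      build : ∀ {k i} (t₁ : Transition O X k) (c₂ : Arrow) (s : Successor) → source c₂ ≡ i →
              sort t₁ ≡ source (proj₁ (proj₂ s)) → 𝐆 i
      build t₁ (_ , _ , c₂) (_ , b , o₂) refl q = single ⟨ c₂ , o₂ , target-state t₁ b q ⟩

      cover₃ : ∀ {k i} → Transition O X k → (c₂ : Arrow) → Successor → source c₂ ≡ i → 𝐆 i
      cover₃ t₁ c₂ s@(_ , b , _) p = guard (em {sort t₁ ≡ source b}) >>= build t₁ c₂ s p

      cover₂ : ∀ {k i} → Transition O X k → Arrow → Successor → 𝐆 i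
      cover₂ {i = i} t₁ c₂ s = guard (em {source c₂ ≡ i}) >>= cover₃ t₁ c₂ s

      cover₁ : ∀ {k i} → Transition O X k → Arrow → 𝐆 i
      cover₁ t₁ c₂ = successors (obs t₁) >>= cover₂ t₁ c₂

      cover₀ : ∀ {k i} → Transition O X k → 𝐆 i
      cover₀ t₁ = arrows >>= cover₁ t₁

      -- Contains every transition derivable from A in any context.
      cover : ∀ {k i} → 𝐆 k → 𝐆 i
      cover A = A >>= cover₀

      Derivable⊆cover : ∀ {k i} {d : Hom k i} (A : 𝐆 k) → Derivable d A ⊆ (_∈ cover A)
      Derivable⊆cover A {t₂} (t , (t₁ , t₁∈ , t₁≈t) , D) = ⟨ ctx t₂ , obs t₂ , e′ · state t₁ ⟩ ,
        >>=-∈ A cover₀ t₁∈ (>>=-∈ arrows (cover₁ t₁) (∈-arrows c₂)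
          (>>=-∈ (successors (obs t₁)) (cover₂ t₁ c₂) (∈-successors derivable)
            (>>=-∈ _ (cover₃ t₁ c₂ s) (refl-∈ em)
              (>>=-∈ _ (build t₁ c₂ s refl) (refl-∈ em) (single-∈ _))))) ,
        state-≈ result
        where
        open _⊢[_]_ (⊢-resp-≈ᵗ (≈ᵗ-sym t₁≈t) ≈ᵗ-refl D)
        c₂ = _ , _ , ctx t₂
        s  = (_ , _ , e) , (_ , _ , e′) , obs t₂

      keep : ∀ {i} {P : Pred (Transition O X i) ℓ} {t} → Dec (P t) → Maybe (Transition O X i)
      keep {t = t} (yes _) = just t
      keep (no _)          = nothing

      filterᴹ : ∀ {i} → Pred (Transition O X i) ℓ → Maybe (Transition O X i) → Maybe (Transition O X i)
      filterᴹ P nothing  = nothing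
      filterᴹ P (just t) = keep {P = P} {t} em

    -- {t ∈ A | P t}
    filter : ∀ {i} → Pred (Transition O X i) ℓ → 𝐆 i → 𝐆 i
    filter P A n = filterᴹ P (A n)

    private
      keep-sound : ∀ {i} {P : Pred (Transition O X i) ℓ} {s t} (d : Dec (P s)) →
                   keep {P = P} d ≡ just t → s ≡ t × P t
      keep-sound (yes p) refl = refl , p

      keep-complete : ∀ {i} {P : Pred (Transition O X i) ℓ} {t} (d : Dec (P t)) → P t →
                      keep {P = P} d ≡ just t
      keep-complete (yes _) _ = refl
      keep-complete (no ¬p) p = contradiction p ¬p

      filterᴹ-sound : ∀ {i} (P : Pred (Transition O X i) ℓ) m {t} →
                      filterᴹ P m ≡ just t → m ≡ just t × P t
      filterᴹ-sound P (just s) eq with keep-sound {P = P} em eq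
      ... | refl , p = refl , p

      ∈-filter⁻ : ∀ {i} (P : Pred (Transition O X i) ℓ) (A : 𝐆 i) {t} →
                  (∀ {s t} → s ≈ᵗ t → P s → P t) → t ∈ filter P A → P t
      ∈-filter⁻ P A resp (s , (n , eq) , s≈t) = resp s≈t (proj₂ (filterᴹ-sound P (A n) eq))

      ∈-filter⁺ : ∀ {i} (P : Pred (Transition O X i) ℓ) (A : 𝐆 i) {t} →
                  (∀ {s t} → s ≈ᵗ t → P s → P t) → t ∈ A → P t → t ∈ filter P A
      ∈-filter⁺ P A resp (s , (n , eq) , s≈t) p =
        s , (n , trans (cong (filterᴹ P) eq) (keep-complete {P = P} em (resp (≈ᵗ-sym s≈t) p))) , s≈t

    post : ∀ {i k} → Hom i k → 𝐆 i → 𝐆 k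
    post d A = filter (Derivable d A) (cover A)

    norm : ∀ {i} → 𝐆 i → 𝐆 i
    norm A = filter (Norm A) (cover A)

    private
      Derivable-resp : ∀ {i k} (d : Hom i k) (A : 𝐆 i) {s t} → s ≈ᵗ t → Derivable d A s → Derivable d A t
      Derivable-resp d A p (r , r∈A , D) = r , r∈A , ⊢-resp-≈ᵗ ≈ᵗ-refl p D

      Norm-resp : ∀ {i} (A : 𝐆 i) {s t} → s ≈ᵗ t → Norm A s → Norm A t
      Norm-resp A p (r , r∈A , q , ¬red) = r , r∈A , ≡ᵗ-trans (≈ᵗ⇒⊢ (≈ᵗ-sym p) , ≈ᵗ⇒⊢ p) q , ¬red

    ∈-post : ∀ {i k} (d : Hom i k) (A : 𝐆 i) → (_∈ post d A) ≐ Derivable d A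
    ∈-post d A = ∈-filter⁻ (Derivable d A) (cover A) (Derivable-resp d A) ,
      λ D → ∈-filter⁺ (Derivable d A) (cover A) (Derivable-resp d A) (Derivable⊆cover A D) D

    ∈-norm : ∀ {i} (A : 𝐆 i) → (_∈ norm A) ≐ Norm A
    ∈-norm A = ∈-filter⁻ (Norm A) (cover A) (Norm-resp A) ,
      λ { N@(t , t∈A , (_ , t⊢t′) , _) →
          ∈-filter⁺ (Norm A) (cover A) (Norm-resp A) (Derivable⊆cover A (t , t∈A , t⊢t′)) N }

    post-cong : ∀ {i k} (d : Hom i k) {A B : 𝐆 i} → A ≈ˢ B → post d A ≈ˢ post d B
    post-cong d A≈B = mono (proj₁ A≈B) , mono (proj₂ A≈B)
      where
      mono : ∀ {A B : 𝐆 _} → (_∈ A) ⊆ (_∈ B) → (_∈ post d A) ⊆ (_∈ post d B)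
      mono {A} {B} A⊆B t∈ with proj₁ (∈-post d A) t∈
      ... | s , s∈A , D = proj₂ (∈-post d B) (s , A⊆B s∈A , D)

    norm-cong : ∀ {i} {A B : 𝐆 i} → A ≈ˢ B → norm A ≈ˢ norm B
    norm-cong A≈B = mono A≈B , mono (≈ˢ-sym A≈B)
      where
      mono : ∀ {A B : 𝐆 _} → A ≈ˢ B → (_∈ norm A) ⊆ (_∈ norm B)
      mono {A} {B} (A⊆B , B⊆A) t∈ with proj₁ (∈-norm A) t∈
      ... | s , s∈A , p , ¬red =
        proj₂ (∈-norm B) (s , A⊆B s∈A , p , λ red → ¬red (Redundant-mono {A = B} {A} B⊆A red))

    post-⨾ : ∀ {i j k} (d : Hom i j) (f : Hom j k) (A : 𝐆 i) → post (d ⨾ f) A ≈ˢ post f (post d A)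
    post-⨾ d f A = left , right
      where
      left : (_∈ post (d ⨾ f) A) ⊆ (_∈ post f (post d A))
      left t∈ with proj₁ (∈-post (d ⨾ f) A) t∈
      ... | s , s∈A , D with ⊢-split D
      ... | r , E , F = proj₂ (∈-post f _) (r , proj₂ (∈-post d A) (s , s∈A , E) , F)

      right : (_∈ post f (post d A)) ⊆ (_∈ post (d ⨾ f) A)
      right t∈ with proj₁ (∈-post f (post d A)) t∈
      ... | r , r∈ , F with proj₁ (∈-post d A) r∈
      ... | s , s∈A , E = proj₂ (∈-post (d ⨾ f) A) (s , s∈A , ⊢-⨾ E F)

    post-saturated : ∀ {i k} (d : Hom i k) (A : 𝐆 i) → Saturated (post d A)
    post-saturated d A t₁∈ D with proj₁ (∈-post d A) t₁∈
    ... | s , s∈A , E = proj₂ (∈-post d A) (s , s∈A , ⊢-idʳ E D)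

    post-id : ∀ {i} {A : 𝐆 i} → Saturated A → post (id i) A ≈ˢ A
    post-id {A = A} sat = left , λ t∈A → proj₂ (∈-post _ A) (_ , t∈A , ⊢-refl)
      where
      left : (_∈ post (id _) A) ⊆ (_∈ A)
      left t∈ with proj₁ (∈-post _ A) t∈
      ... | s , s∈A , D = sat s∈A D

    norm-normalized : ∀ {i} (A : 𝐆 i) → Normalized (norm A)
    norm-normalized A = irredundant , closed
      where
      irredundant : ∀ {t} → t ∈ norm A → ¬ Redundant (norm A) t
      irredundant t∈ (t′ , t′∈ , t′⊢t , t⊬t′) with proj₁ (∈-norm A) t∈ | proj₁ (∈-norm A) t′∈
      ... | s , s∈A , (t⊢s , s⊢t) , ¬red | s′ , s′∈A , (t′⊢s′ , s′⊢t′) , _ =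
        ¬red (s′ , s′∈A , ⊢-trans s′⊢t′ (⊢-trans t′⊢t t⊢s) ,
              λ s⊢s′ → t⊬t′ (⊢-trans t⊢s (⊢-trans s⊢s′ s′⊢t′)))

      closed : ∀ {t′ t} → t ∈ norm A → t′ ≡ᵗ t → t′ ∈ norm A
      closed t∈ p with proj₁ (∈-norm A) t∈
      ... | s , s∈A , q , ¬red = proj₂ (∈-norm A) (s , s∈A , ≡ᵗ-trans p q , ¬red)

    norm-fixed : ∀ {i} {A : 𝐆 i} → Normalized A → norm A ≈ˢ A
    norm-fixed {A = A} (irredundant , closed) = left ,
      λ t∈A → proj₂ (∈-norm A) (_ , t∈A , (⊢-refl , ⊢-refl) , irredundant t∈A)
      where
      left : (_∈ norm A) ⊆ (_∈ A)
      left t∈ with proj₁ (∈-norm A) t∈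
      ... | s , s∈A , p , _ = closed s∈A p

    norm-post-id : ∀ {i} (A : 𝐆 i) → norm (post (id i) A) ≈ˢ norm A
    norm-post-id {i} A = left , right
      where
      A⊆post : (_∈ A) ⊆ (_∈ post (id i) A)
      A⊆post t∈A = proj₂ (∈-post _ A) (_ , t∈A , ⊢-refl)

      left : (_∈ norm (post (id i) A)) ⊆ (_∈ norm A)
      left t∈ with proj₁ (∈-norm (post (id i) A)) t∈
      ... | s , s∈ , p , ¬red with proj₁ (∈-post _ A) s∈
      ... | a , a∈A , a⊢s with em {s ⊢ a}
      ... | no s⊬a   = contradiction (a , A⊆post a∈A , a⊢s , s⊬a) ¬red
      ... | yes s⊢a = proj₂ (∈-norm A) (a , a∈A , ≡ᵗ-trans p (s⊢a , a⊢s) ,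
        λ { (r , r∈A , r⊢a , a⊬r) →
            ¬red (r , A⊆post r∈A , ⊢-trans r⊢a a⊢s , λ s⊢r → a⊬r (⊢-trans a⊢s s⊢r)) })

      right : (_∈ norm A) ⊆ (_∈ norm (post (id i) A))
      right t∈ with proj₁ (∈-norm A) t∈
      ... | s , s∈A , p , ¬red = proj₂ (∈-norm _) (s , A⊆post s∈A , p , λ red → ¬red (back red))
        where
        back : Redundant (post (id i) A) s → Redundant A s
        back (r , r∈ , r⊢s , s⊬r) with proj₁ (∈-post _ A) r∈
        ... | a , a∈A , a⊢r = a , a∈A , ⊢-trans a⊢r r⊢s , λ s⊢a → s⊬r (⊢-trans s⊢a a⊢r)

    module _ (noChain : ¬ InfiniteDescendingChain) where

      -- Every element of A is derivable from an irredundant one.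
      irredundant-below : ∀ {i} (A : 𝐆 i) {t} → t ∈ A → ∃[ s ] s ∈ A × s ⊢ t × ¬ Redundant A s
      irredundant-below {i} A {t} t∈A with em {∃[ s ] s ∈ A × s ⊢ t × ¬ Redundant A s}
      ... | yes found   = found
      ... | no notFound = contradiction (i , (λ n → proj₁ (chain n)) , descending) noChain
        where
        Below : Set ℓ
        Below = ∃[ s ] s ∈ A × s ⊢ t

        dominated : (b : Below) → Redundant A (proj₁ b)
        dominated (s , s∈A , s⊢t) with em {Redundant A s}
        ... | yes red = red
        ... | no ¬red = contradiction (s , s∈A , s⊢t , ¬red) notFound

        chain : ℕ → Below
        chain zero      = t , t∈A , ⊢-refl
        chain (ℕ.suc n) with dominated (chain n)
        ... | s , s∈A , s⊢t′ , _ = s , s∈A , ⊢-trans s⊢t′ (proj₂ (proj₂ (chain n)))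

        descending : ∀ n → proj₁ (chain (ℕ.suc n)) ≺ proj₁ (chain n)
        descending n with dominated (chain n)
        ... | _ , _ , d = d

      post-norm : ∀ {i k} (d : Hom i k) (A : 𝐆 i) → post d (norm A) ≈ˢ post d A
      post-norm d A = left , right
        where
        left : (_∈ post d (norm A)) ⊆ (_∈ post d A)
        left t∈ with proj₁ (∈-post d (norm A)) t∈
        ... | s , s∈ , D with proj₁ (∈-norm A) s∈
        ... | r , r∈A , (_ , r⊢s) , _ = proj₂ (∈-post d A) (r , r∈A , ⊢-idˡ r⊢s D)

        right : (_∈ post d A) ⊆ (_∈ post d (norm A))
        right t∈ with proj₁ (∈-post d A) t∈
        ... | s , s∈A , D with irredundant-below A s∈A
        ... | r , r∈A , r⊢s , ¬red = proj₂ (∈-post d (norm A))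
          (r , proj₂ (∈-norm A) (r , r∈A , (⊢-refl , ⊢-refl) , ¬red) , ⊢-idˡ r⊢s D)

  module _ {X Y : Algebra C} (h : Homomorphism X Y) where
    private
      module SX = Sets O X
      module SY = Sets O Y
      module DX = Derivation T X
      module DY = Derivation T Y

    𝐆₁-cong : ∀ {i} {A B : SX.𝐆 i} → A SX.≈ˢ B → 𝐆₁ {O = O} h A SY.≈ˢ 𝐆₁ h B
    𝐆₁-cong (A⊆B , B⊆A) = mono A⊆B , mono B⊆A
      where
      mono : ∀ {A B : SX.𝐆 _} → (SX._∈ A) ⊆ (SX._∈ B) → (SY._∈ 𝐆₁ h A) ⊆ (SY._∈ 𝐆₁ h B)
      mono {A} {B} A⊆B t∈ with proj₁ (∈-𝐆₁ h A) t∈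
      ... | s , s∈A , p = proj₂ (∈-𝐆₁ h B) (s , A⊆B s∈A , p)

    𝐆₁-post : ∀ {i k} (d : Hom i k) (A : SX.𝐆 i) →
              𝐆₁ {O = O} h (post X d A) SY.≈ˢ post Y d (𝐆₁ h A)
    𝐆₁-post d A = left , right
      where
      left : (SY._∈ 𝐆₁ h (post X d A)) ⊆ (SY._∈ post Y d (𝐆₁ h A))
      left t∈ with proj₁ (∈-𝐆₁ h (post X d A)) t∈
      ... | s , s∈ , p with proj₁ (∈-post X d A) s∈
      ... | r , r∈A , D = proj₂ (∈-post Y d (𝐆₁ h A))
        ( mapᵗ h r , proj₂ (∈-𝐆₁ h A) (r , r∈A , SY.≈ᵗ-refl)
        , DY.⊢-resp-≈ᵗ SY.≈ᵗ-refl p (mapᵗ-⊢ T h D))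

      right : (SY._∈ post Y d (𝐆₁ h A)) ⊆ (SY._∈ 𝐆₁ h (post X d A))
      right t∈ with proj₁ (∈-post Y d (𝐆₁ h A)) t∈
      ... | s , s∈ , D with proj₁ (∈-𝐆₁ h A) s∈
      ... | r , r∈A , p with mapᵗ-⊢⁻¹ T h (DY.⊢-resp-≈ᵗ (SY.≈ᵗ-sym p) SY.≈ᵗ-refl D)
      ... | q , E , p′ = proj₂ (∈-𝐆₁ h (post X d A)) (q , proj₂ (∈-post X d A) (r , r∈A , E) , p′)

    𝐆₁-saturated : ∀ {i} {A : SX.𝐆 i} → DX.Saturated A → DY.Saturated (𝐆₁ h A)
    𝐆₁-saturated {A = A} sat t₁∈ D with proj₁ (∈-𝐆₁ h A) t₁∈
    ... | s , s∈A , p with mapᵗ-⊢⁻¹ T h (DY.⊢-resp-≈ᵗ (SY.≈ᵗ-sym p) SY.≈ᵗ-refl D)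
    ... | r , E , p′ = proj₂ (∈-𝐆₁ h A) (r , sat s∈A E , p′)

    module _ (noChain : ¬ DX.InfiniteDescendingChain) where

      norm-𝐆₁-norm : ∀ {i} (A : SX.𝐆 i) → norm Y (𝐆₁ h (norm X A)) SY.≈ˢ norm Y (𝐆₁ h A)
      norm-𝐆₁-norm A =
        SY.≈ˢ-trans (SY.≈ˢ-sym (norm-post-id Y (𝐆₁ h (norm X A))))
        (SY.≈ˢ-trans (norm-cong Y (SY.≈ˢ-sym (𝐆₁-post (id _) (norm X A))))
        (SY.≈ˢ-trans (norm-cong Y (𝐆₁-cong (post-norm X noChain (id _) A)))
        (SY.≈ˢ-trans (norm-cong Y (𝐆₁-post (id _) A))
        (norm-post-id Y (𝐆₁ h A)))))

  𝐆₁-ext : ∀ {X Y : Algebra C} (f g : Homomorphism X Y) →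
           (∀ {i} (x : Algebra.∣_∣ X i) → Algebra._≈_ Y (Homomorphism.app f x) (Homomorphism.app g x)) →
           ∀ {i} (A : Sets.𝐆 O X i) → Sets._≈ˢ_ O Y (𝐆₁ f A) (𝐆₁ g A)
  𝐆₁-ext {X} {Y} f g f≈g A = mono f g f≈g , mono g f (λ x → Algebra.≈-sym Y (f≈g x))
    where
    open Sets O Y
    mono : ∀ (f g : Homomorphism X Y) →
           (∀ {i} (x : Algebra.∣_∣ X i) → Algebra._≈_ Y (Homomorphism.app f x) (Homomorphism.app g x)) →
           (_∈ 𝐆₁ f A) ⊆ (_∈ 𝐆₁ g A)
    mono f g f≈g t∈ with proj₁ (∈-𝐆₁ f A) t∈
    ... | s , s∈A , p =
      proj₂ (∈-𝐆₁ g A) (s , s∈A , ≈ᵗ-trans (state-≈ (Algebra.≈-sym Y (f≈g (state s)))) p)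

  𝐆₁-id : ∀ {X : Algebra C} {i} (A : Sets.𝐆 O X i) →
          Sets._≈ˢ_ O X (𝐆₁ (Category.idA (Alg C) X) A) A
  𝐆₁-id {X} A = left , λ t∈A → proj₂ (∈-𝐆₁ (Category.idA (Alg C) X) A) (_ , t∈A , ≈ᵗ-refl)
    where
    open Sets O X
    left : (_∈ 𝐆₁ (Category.idA (Alg C) X) A) ⊆ (_∈ A)
    left t∈ with proj₁ (∈-𝐆₁ (Category.idA (Alg C) X) A) t∈
    ... | s , s∈A , p = ∈-resp-≈ᵗ {A = A} p s∈A

  𝐆₁-⨾ : ∀ {X Y Z : Algebra C} (f : Homomorphism X Y) (g : Homomorphism Y Z) {i} (A : Sets.𝐆 O X i) →
         Sets._≈ˢ_ O Z (𝐆₁ (Category._⨾_ (Alg C) f g) A) (𝐆₁ g (𝐆₁ f A))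
  𝐆₁-⨾ {X} {Y} {Z} f g A = left , right
    where
    open Sets O Z
    fg = Category._⨾_ (Alg C) f g

    left : (_∈ 𝐆₁ fg A) ⊆ (_∈ 𝐆₁ g (𝐆₁ f A))
    left t∈ with proj₁ (∈-𝐆₁ fg A) t∈
    ... | s , s∈A , p = proj₂ (∈-𝐆₁ g (𝐆₁ f A))
      (mapᵗ f s , proj₂ (∈-𝐆₁ f A) (s , s∈A , Sets.≈ᵗ-refl O Y) , p)

    right : (_∈ 𝐆₁ g (𝐆₁ f A)) ⊆ (_∈ 𝐆₁ fg A)
    right t∈ with proj₁ (∈-𝐆₁ g (𝐆₁ f A)) t∈
    ... | s , s∈ , p with proj₁ (∈-𝐆₁ f A) s∈
    ... | r , r∈A , q = proj₂ (∈-𝐆₁ fg A) (r , r∈A , ≈ᵗ-trans (mapᵗ-cong g q) p)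

------------------------------------------------------------------------
-- The endofunctors 𝐒 and 𝐍

  setsWith : (X : Algebra C) → (∀ {i} → Pred (Sets.𝐆 O X i) ℓ) → Obj → Setoid ℓ ℓ
  setsWith X P i = record
    { Carrier       = Σ[ A ∈ Sets.𝐆 O X i ] P A
    ; _≈_           = λ A B → proj₁ A ≈ˢ proj₁ B
    ; isEquivalence = record { refl = ≈ˢ-refl ; sym = ≈ˢ-sym ; trans = ≈ˢ-trans }
    }
    where open Sets O X

  -- Defined by copatterns, as unfolding during conversion checking is costly.
  𝐒₀ : Algebra C → Algebra C
  𝐒₀ X .Algebra.Carrier = setsWith X (Derivation.Saturated T X)
  𝐒₀ X .Algebra.op d    = record
    { to   = λ (A , _) → post X d A , post-saturated X d A
    ; cong = post-cong X d
    }
  𝐒₀ X .Algebra.op-id (A , sat)   = post-id X sat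
  𝐒₀ X .Algebra.op-⨾ d e (A , _) = post-⨾ X d e A

  𝐒₁ : ∀ {X Y} → Homomorphism X Y → Homomorphism (𝐒₀ X) (𝐒₀ Y)
  𝐒₁ h .Homomorphism.fun i = record
    { to   = λ (A , sat) → 𝐆₁ h A , 𝐆₁-saturated h sat
    ; cong = 𝐆₁-cong h
    }
  𝐒₁ h .Homomorphism.natural d (A , _) = 𝐆₁-post h d A

  𝐒 : Functor (Alg C) (Alg C)
  𝐒 .Functor.F₀                                    = 𝐒₀
  𝐒 .Functor.F₁                                    = 𝐒₁
  𝐒 .Functor.F₀-cong                               = cong 𝐒₀
  𝐒 .Functor.F₁-cong {f = f} (pointwise {g} p) = pointwise (λ (A , _) → 𝐆₁-ext f g p A)
  𝐒 .Functor.F-id X                                = pointwise (λ (A , _) → 𝐆₁-id A)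
  𝐒 .Functor.F-⨾ f g                               = pointwise (λ (A , _) → 𝐆₁-⨾ f g A)

  module _ (nrm : Normalizable T) where

    𝐍₀ : Algebra C → Algebra C
    𝐍₀ X .Algebra.Carrier = setsWith X (Derivation.Normalized T X)
    𝐍₀ X .Algebra.op d    = record
      { to   = λ (A , _) → norm X (post X d A) , norm-normalized X (post X d A)
      ; cong = λ A≈B → norm-cong X (post-cong X d A≈B)
      }
    𝐍₀ X .Algebra.op-id (A , N) = Sets.≈ˢ-trans O X (norm-post-id X A) (norm-fixed X N)
    𝐍₀ X .Algebra.op-⨾ d e (A , _) = norm-cong X
      (≈ˢ-trans (post-⨾ X d e A) (≈ˢ-sym (post-norm X (nrm X) e (post X d A))))
      where open Sets O X

    𝐍₁ : ∀ {X Y} → Homomorphism X Y → Homomorphism (𝐍₀ X) (𝐍₀ Y)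
    𝐍₁ {X} {Y} h .Homomorphism.fun i = record
      { to   = λ (A , _) → norm Y (𝐆₁ h A) , norm-normalized Y (𝐆₁ h A)
      ; cong = λ A≈B → norm-cong Y (𝐆₁-cong h A≈B)
      }
    𝐍₁ {X} {Y} h .Homomorphism.natural d (A , _) =
      ≈ˢ-trans (norm-𝐆₁-norm h (nrm X) (post X d A))
      (norm-cong Y (≈ˢ-trans (𝐆₁-post h d A) (≈ˢ-sym (post-norm Y (nrm Y) d (𝐆₁ h A)))))
      where open Sets O Y

    𝐍 : Functor (Alg C) (Alg C)
    𝐍 .Functor.F₀      = 𝐍₀
    𝐍 .Functor.F₁      = 𝐍₁
    𝐍 .Functor.F₀-cong = cong 𝐍₀
    𝐍 .Functor.F₁-cong {B = Y} {f = f} (pointwise {g} p) =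
      pointwise (λ (A , _) → norm-cong Y (𝐆₁-ext f g p A))
    𝐍 .Functor.F-id X = pointwise (λ (A , N) →
      Sets.≈ˢ-trans O X (norm-cong X (𝐆₁-id A)) (norm-fixed X N))
    𝐍 .Functor.F-⨾ {B = Y} {Z} f g = pointwise (λ (A , _) →
      Sets.≈ˢ-trans O Z (norm-cong Z (𝐆₁-⨾ f g A))
        (Sets.≈ˢ-sym O Z (norm-𝐆₁-norm g (nrm Y) (𝐆₁ f A))))

{-# OPTIONS --safe #-}

-- Saturation post(id) and normalization norm are mutually inverse between
-- saturated and normalized sets: normalizing loses no derivable transition,
-- because without infinite descending chains every transition of A is derivable
-- from an irredundant one.  Both are natural and commute with the operations,
-- so 𝐒 and 𝐍 are isomorphic functors, and naturally isomorphic endofunctors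
-- have isomorphic categories of coalgebras.
module Submission where

open import Level using (suc)
open import Axiom.ExcludedMiddle using (ExcludedMiddle)
open import Data.Product using (_,_)
open import Relation.Binary.PropositionalEquality using (refl; subst)
open import Defs

module _ {ℓ} {𝒞 𝒟 : Category ℓ} where
  private
    module 𝒞 = Category 𝒞
  open Category 𝒟
  open Functor

  -- The field `cong` is needed because objects are equal only up to `≈ₒ`: equal coalgebras must
  -- stay equal after composing with components.
  record NaturalTransformation (F G : Functor 𝒞 𝒟) : Set (suc ℓ) where
    field
      component : ∀ A → F₀ F A ⇒ F₀ G A
      cong      : ∀ {A B} → A 𝒞.≈ₒ B → component A ≋ component B
      natural   : ∀ {A B} (f : A 𝒞.⇒ B) → component A ⨾ F₁ G f ≋ F₁ F f ⨾ component B

module _ {ℓ} {𝒞 : Category ℓ} where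
  open Category 𝒞
  open Coalgebra
  open CoalgebraMorphism
  open NaturalTransformation

  postcompose : {F G : Functor 𝒞 𝒞} → NaturalTransformation F G → Functor (Coalg F) (Coalg G)
  postcompose {F} η = record
    { F₀      = λ P → record
      { carrier   = carrier P
      ; structure = structure P ⨾ component η (carrier P)
      }
    ; F₁      = λ f → record
      { hom      = hom f
      ; commutes = ≋-trans (assoc _ _ _)
                     (≋-trans (⨾-cong ≋-refl (natural η (hom f)))
                     (≋-trans (≋-sym (assoc _ _ _))
                     (≋-trans (⨾-cong (commutes f) ≋-refl)
                     (assoc _ _ _))))
      }
    ; F₀-cong = λ { [ p ] → [ structure-cong p ] }
    ; F₁-cong = λ { (mk≋ p q r) → mk≋ (structure-cong p) (structure-cong q) r }
    ; F-id    = λ _ → mk≋ ≋-refl ≋-refl ≋-refl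
    ; F-⨾     = λ _ _ → mk≋ ≋-refl ≋-refl ≋-refl
    }
    where
    structure-cong : {P Q : Coalgebra F} → structure P ≋ structure Q →
                     structure P ⨾ component η (carrier P) ≋ structure Q ⨾ component η (carrier Q)
    structure-cong p = ⨾-cong p (cong η (≋-source p))

  -- Both functors keep carriers and homs, so only the structures need comparing, and there the two
  -- components cancel.
  Coalg-≅ : {F G : Functor 𝒞 𝒞} (η : NaturalTransformation F G) (ε : NaturalTransformation G F) →
            (∀ A → component η A ⨾ component ε A ≋ idA (Functor.F₀ F A)) →
            (∀ A → component ε A ⨾ component η A ≋ idA (Functor.F₀ G A)) →
            Coalg F ≅ Coalg G
  Coalg-≅ η ε η⨾ε≋id ε⨾η≋id = record
    { to       = postcompose η
    ; from     = postcompose ε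
    ; from∘to₀ = λ P → [ cancel (η⨾ε≋id (carrier P)) ]
    ; from∘to₁ = λ _ → mk≋ (cancel (η⨾ε≋id _)) (cancel (η⨾ε≋id _)) ≋-refl
    ; to∘from₀ = λ P → [ cancel (ε⨾η≋id (carrier P)) ]
    ; to∘from₁ = λ _ → mk≋ (cancel (ε⨾η≋id _)) (cancel (ε⨾η≋id _)) ≋-refl
    }
    where
    cancel : ∀ {A B D} {f : A ⇒ B} {g : B ⇒ D} {h : D ⇒ B} → g ⨾ h ≋ idA B → (f ⨾ g) ⨾ h ≋ f
    cancel p = ≋-trans (assoc _ _ _) (≋-trans (⨾-cong ≋-refl p) (identityʳ _))

module Isomorphism {ℓ} (em : ExcludedMiddle ℓ) {C : SmallCategory ℓ} (arr : CountablyManyArrows C)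
         {O : Set ℓ} (T : InferenceSystem C O) (br : CountablyBranching T) (nrm : Normalizable T) where
  open SmallCategory C using (id; identityˡ)
  open Category (Alg C) using (_⨾_; _≋_; idA; ≋-refl)
  open Endofunctors em arr T br
  open NaturalTransformation using (component)

  post-id-post : ∀ X {i k} (d : SmallCategory.Hom C i k) (A : Sets.𝐆 O X i) →
                 Sets._≈ˢ_ O X (post X d A) (post X d (post X (id i) A))
  post-id-post X {i} d A =
    subst (λ f → Sets._≈ˢ_ O X (post X f A) (post X d (post X (id i) A))) (identityˡ d) (post-⨾ X (id i) d A)

  -- Normalizability enters here: the irredundant transitions kept by `norm` still derive all of
  -- `A`.
  saturation-norm : ∀ X {i} {A : Sets.𝐆 O X i} → Derivation.Saturated T X A →
                    Sets._≈ˢ_ O X (post X (id i) (norm X A)) A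
  saturation-norm X {A = A} sat = Sets.≈ˢ-trans O X (post-norm X (nrm X) (id _) A) (post-id X sat)

  normalization : NaturalTransformation 𝐒 (𝐍 nrm)
  normalization = record
    { component = onSets
    ; cong      = λ { refl → ≋-refl }
    ; natural   = λ {X} h → pointwise (λ (A , _) → norm-𝐆₁-norm h (nrm X) A)
    }
    where
    onSets : ∀ X → Homomorphism (𝐒₀ X) (𝐍₀ nrm X)
    onSets X .Homomorphism.fun i = record
      { to   = λ (A , _) → norm X A , norm-normalized X A
      ; cong = norm-cong X
      }
    -- The operation of `𝐍₀` derives from `norm X A` rather than `A`, which yields the same set.
    onSets X .Homomorphism.natural d (A , _) =
      norm-cong X (Sets.≈ˢ-sym O X (post-norm X (nrm X) d A))

  saturation : NaturalTransformation (𝐍 nrm) 𝐒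
  saturation = record
    { component = onSets
    ; cong      = λ { refl → ≋-refl }
    -- Both composites equal the saturation of `𝐆₁ h A`.
    ; natural   = λ {_} {Y} h → pointwise (λ (A , _) →
        Sets.≈ˢ-trans O Y (𝐆₁-post h (id _) A)
          (Sets.≈ˢ-sym O Y (post-norm Y (nrm Y) (id _) (𝐆₁ h A))))
    }
    where
    onSets : ∀ X → Homomorphism (𝐍₀ nrm X) (𝐒₀ X)
    onSets X .Homomorphism.fun i = record
      { to   = λ (A , _) → post X (id i) A , post-saturated X (id i) A
      ; cong = post-cong X (id i)
      }
    -- Both sides equal `post X d A`: it is saturated, so normalizing and resaturating restores it,
    -- and saturating `A` beforehand adds nothing derivable in context `d`.
    onSets X .Homomorphism.natural d (A , _) =
      Sets.≈ˢ-trans O X (saturation-norm X (post-saturated X d A)) (post-id-post X d A)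

  normalization-saturation : ∀ X → component normalization X ⨾ component saturation X ≋ idA (𝐒₀ X)
  normalization-saturation X = pointwise λ (_ , sat) → saturation-norm X sat

  -- Each transition added by saturation is dominated by, or equivalent to, the one in `A` deriving
  -- it, so `norm` sees no difference.
  saturation-normalization : ∀ X → component saturation X ⨾ component normalization X ≋ idA (𝐍₀ nrm X)
  saturation-normalization X = pointwise λ (A , N) →
    Sets.≈ˢ-trans O X (norm-post-id X A) (norm-fixed X N)

  Coalg-𝐒≅Coalg-𝐍 : Coalg 𝐒 ≅ Coalg (𝐍 nrm)
  Coalg-𝐒≅Coalg-𝐍 = Coalg-≅ normalization saturation
    normalization-saturation saturation-normalization

theorem7p15 : ∀ {ℓ} (em : ExcludedMiddle ℓ) (C : SmallCategory ℓ) (arr : CountablyManyArrows C) (O : Set ℓ)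
    (T : InferenceSystem C O) (br : CountablyBranching T) (nrm : Normalizable T) →
    Coalg (Endofunctors.𝐒 em arr T br) ≅ Coalg (Endofunctors.𝐍 em arr T br nrm)
theorem7p15 em C arr O T br nrm = Coalg-𝐒≅Coalg-𝐍
  where open Isomorphism em arr T br nrm using (Coalg-𝐒≅Coalg-𝐍)
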